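{- Let $d, w \in \mathbb{N}$ with $d > 1$ and $0 \leq w < 2^{d-1}$. Let $s = (s_0,\dotsc,s_{n-1})$ ($n \ge 0$) and $t = (t_0,\dotsc,t_{m-1})$ ($m \ge 1$) be Boolean input variables with arrival times in $\mathbb{N}$ such that $W(s) = w$ and \[ W(t) \leq 1.9 \cdot \frac{2^{d-1} - w}{d \log_2 (d)} + \frac{d-1}{d} \Lambda_t. \] Then there is a Boolean circuit over $\{\land,\lor\}$ realizing $f(s, t)$ with delay at most $d$.
   Context: For Boolean variables $t = (t_0, \dotsc, t_{m-1})$ with $m \geq 1$, define recursively $g(t) = g^*(t) = t_0$ if $m=1$, and for $m>1$, $g(t) = t_0 \land g^*((t_1, \dotsc, t_{m-1}))$, $g^*(t) = t_0 \lor g((t_1, \dotsc, t_{m-1}))$. For $s = (s_0,\dotsc,s_{n-1})$ (possibly empty), $f(s,t) = s_0 \land \dotsb \land s_{n-1} \land g(t)$. A Boolean circuit over $\{\land,\lor\}$ is a directed acyclic graph whose indegree-0 nodes (inputs) are labeled by Boolean variables, with a unique outdegree-0 node (output) of indegree 1, and all other nodes are gates of indegree exactly 2 labeled \textsc{And} or \textsc{Or}; it realizes a Boolean function if its output computes that function for all input values. Each input variable $x$ has an arrival time $a(x) \in \mathbb{N}$; the delay of input $x$ is $a(x)$ plus the maximum number of gates on any directed path starting at $x$, and the delay of the circuit is the maximum delay over its inputs. The weight of an input is $W(x) = 2^{a(x)}$, and the weight of a tuple of inputs is the sum of the weights of its entries (empty tuple: $0$). For $t = (t_0,\dotsc,t_{m-1})$,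 $\Lambda_t := W(t_0)$ if $m = 1$ and $\Lambda_t := W(t_{m-2}) + W(t_{m-1})$ if $m > 1$. -}

module Defs where

open import Data.Nat using (ℕ; zero; suc; _+_; _*_; _∸_; _^_; _≤_; _<_)
open import Data.Bool using (Bool; true; false; _∧_; _∨_)
open import Data.Fin using (Fin; toℕ)
open import Data.Vec using (Vec; []; _∷_; lookup; tabulate; map; foldr)
open import Data.Sum using (_⊎_; inj₁; inj₂)
open import Data.Product using (Σ; ∃; _×_; _,_)
open import Relation.Binary.PropositionalEquality using (_≡_)

mutual
  g : ∀ {k} → Vec Bool (suc k) → Bool
  g (x ∷ [])     = x
  g (x ∷ y ∷ r)  = x ∧ g* (y ∷ r)

  g* : ∀ {k} → Vec Bool (suc k) → Bool
  g* (x ∷ [])    = x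
  g* (x ∷ y ∷ r) = x ∨ g (y ∷ r)

⋀ : ∀ {n} → Vec Bool n → Bool
⋀ = foldr _ _∧_ true

f : ∀ {n k} → Vec Bool n → Vec Bool (suc k) → Bool
f s t = ⋀ s ∧ g t

-- Weights.  Arrival times are given as vectors; W(x) = 2^a(x).

W : ∀ {n} → Vec ℕ n → ℕ
W = foldr _ (λ a r → 2 ^ a + r) 0

Λ : ∀ {k} → Vec ℕ (suc k) → ℕ
Λ (a ∷ [])         = 2 ^ a
Λ (a ∷ b ∷ [])     = 2 ^ a + 2 ^ b
Λ (a ∷ b ∷ c ∷ r)  = Λ (b ∷ c ∷ r)

-- Real-number bound, encoded exactly in ℕ.
--
-- For naturals x, y and d ≥ 1:   x · log₂ d ≤ y   ⟺   d ^ x ≤ 2 ^ y.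
_·log₂_≤_ : ℕ → ℕ → ℕ → Set
x ·log₂ d ≤ y = d ^ x ≤ 2 ^ y

-- The hypothesis
--   W(t) ≤ 1.9 · (2^{d-1} - w) / (d · log₂ d) + (d-1)/d · Λ_t
-- (with d > 1 and w < 2^{d-1}) is equivalent to
--   (d·W(t) - (d-1)·Λ_t) · log₂ d ≤ 1.9 · (2^{d-1} - w),
-- i.e. (multiplying by 10)
--   10·(d·W(t) - (d-1)·Λ_t) · log₂ d ≤ 19 · (2^{d-1} - w).
-- If d·W(t) - (d-1)·Λ_t ≤ 0 the inequality holds trivially, which is
-- exactly what the truncated subtraction ∸ produces (d^0 = 1 ≤ 2^_).
PaperBound : (d w Wt Λt : ℕ) → Set
PaperBound d w Wt Λt =
  (10 * (d * Wt ∸ (d ∸ 1) * Λt)) ·log₂ d ≤ (19 * (2 ^ (d ∸ 1) ∸ w))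

-- Boolean circuits over {And, Or}, as DAGs.
--
-- Nodes are Fin size.  Each node is either an input node labelled by a
-- variable (indegree 0) or a gate with exactly two predecessors.
-- The (unique, indegree-1) output node is represented by the pointer
-- `out` to its unique predecessor; it is not itself a gate.

data Op : Set where
  AND OR : Op

⟦_⟧ : Op → Bool → Bool → Bool
⟦ AND ⟧ = _∧_
⟦ OR  ⟧ = _∨_

data NodeLabel (V : Set) (k : ℕ) : Set where
  input : V → NodeLabel V k
  gate  : Op → Fin k → Fin k → NodeLabel V k

record Circuit (V : Set) : Set where
  field
    size : ℕ
    node : Fin size → NodeLabel V size
    out  : Fin size
    acyclic : ∀ i op j l → node i ≡ gate op j l → toℕ j < toℕ i × toℕ l < toℕ i

  Edge : Fin size → Fin size → Set
  Edge u v = ∃ λ op → ∃ λ l → node v ≡ gate op u l ⊎ node v ≡ gate op l u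

  field
    onlySink : ∀ u → u ≡ out ⊎ ∃ λ v → Edge u v

  isGate : Fin size → ℕ
  isGate u with node u
  ... | input _    = 0
  ... | gate _ _ _ = 1

  data Path : Fin size → ℕ → Set where
    stop : ∀ {u} → Path u (isGate u)
    step : ∀ {u v c} → Edge u v → Path v c → Path u (isGate u + c)

  Consistent : (V → Bool) → (Fin size → Bool) → Set
  Consistent α val = ∀ i → ConsistentAt (node i) (val i)
    where
    ConsistentAt : NodeLabel V size → Bool → Set
    ConsistentAt (input x)      b = b ≡ α x
    ConsistentAt (gate op j l)  b = b ≡ ⟦ op ⟧ (val j) (val l)

  -- the circuit realizes F (since the circuit is acyclic, consistent
  -- valuations exist and are unique)
  Realizes : ((V → Bool) → Bool) → Set
  Realizes F = ∀ α val → Consistent α val → val out ≡ F α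

  DelayAtMost : (V → ℕ) → ℕ → Set
  DelayAtMost a D = ∀ u x → node u ≡ input x → ∀ c → Path u c → a x + c ≤ D

Var : ℕ → ℕ → Set
Var n m = Fin n ⊎ Fin (suc m)

arrival : ∀ {n m} → Vec ℕ n → Vec ℕ (suc m) → Var n m → ℕ
arrival as at (inj₁ i) = lookup as i
arrival as at (inj₂ j) = lookup at j

fST : ∀ {n m} → (Var n m → Bool) → Bool
fST α = f (tabulate (λ i → α (inj₁ i))) (tabulate (λ j → α (inj₂ j)))

module Submission where

-- With d = e + 1, R the weight of all but the last two entries of t and w = W(s), the hypothesis
-- reads (d R + Λ) log₂ d ≤ 1.9 (2^e - w), and the proof is by induction on d.
-- If w ≥ 2^(e-1), then ⋀ s and g(t) can be built separately with delay d - 1.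
-- Otherwise, for an odd prefix t' = (t₀, …, t₂ₗ) of t with remainder t'',
--   f(s, t) = f(s, t') ∧ f*((t₁, t₃, …, t₂ₗ₋₁), t''),
-- where f* is the dual of f. Take t' maximal subject to f(s, t') satisfying the hypothesis
-- for d - 1. Since the next odd prefix violates it, subtracting exponents shows that the second
-- factor satisfies it, provided that 1.9 ≤ log₂ (d - 1), i.e. d ≥ 5.
-- When t'' has at most three entries, and for d ≤ 4, Huffman coding is enough, except that
-- an entry of weight at least 2^(e-1) among the last two has to be split off alone.

open import Defs
open import Algebra.Properties.CommutativeSemigroup using (x∙yz≈y∙xz)
open import Data.Bool using (Bool; true; false; _∧_)
open import Data.Bool.Properties
  using (∧-assoc; ∨-assoc; ∧-comm; ∨-comm; ∧-identityʳ; ∨-identityʳ; ∧-distribˡ-∨; ∨-distribˡ-∧)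
open import Data.Fin using (Fin; zero; suc; toℕ; _↑ˡ_; _↑ʳ_; splitAt)
open import Data.Fin.Properties
  using (toℕ-↑ˡ; toℕ-↑ʳ; toℕ<n; splitAt-↑ˡ; splitAt-↑ʳ; splitAt⁻¹-↑ˡ; splitAt⁻¹-↑ʳ)
open import Data.List using (List; []; _∷_; _++_; foldr; map)
open import Data.List.Properties using (foldr-++; foldr-map)
open import Data.Nat
  using (ℕ; zero; suc; _+_; _*_; _∸_; _^_; _≤_; _<_; _⊔_; z≤n; s≤s; _≤?_; _<?_)
open import Data.Nat.Properties
open import Data.Nat.Tactic.RingSolver using (solve-∀)
open import Data.Product using (Σ; ∃; _×_; _,_; proj₁; proj₂)
open import Data.Sum using (_⊎_; inj₁; inj₂)
open import Data.Vec as Vec using (Vec; []; _∷_)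
open import Data.Vec.Properties using (tabulate-∘; tabulate∘lookup)
open import Relation.Binary.PropositionalEquality
open import Relation.Nullary using (¬_; Dec; yes; no)
open import Relation.Nullary.Decidable using (from-no; map′)
open import Relation.Nullary.Negation using (contradiction)

private variable
  V : Set

-- Formulas as circuits

data Formula (V : Set) : Set where
  leaf : V → Formula V
  node : Op → Formula V → Formula V → Formula V

eval : Formula V → (V → Bool) → Bool
eval (leaf x)     α = α x
eval (node o φ ψ) α = ⟦ o ⟧ (eval φ α) (eval ψ α)

delay : (V → ℕ) → Formula V → ℕ
delay a (leaf x)     = a x
delay a (node o φ ψ) = suc (delay a φ ⊔ delay a ψ)

-- Occurrences of subformulas, which become the nodes: equal subformulas at different places stay
-- distinct, so the circuit is a tree up to the numbering of its nodes.
data Pos {V : Set} : Formula V → Set where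
  root  : ∀ {φ} → Pos φ
  left  : ∀ {o φ ψ} → Pos φ → Pos (node o φ ψ)
  right : ∀ {o φ ψ} → Pos ψ → Pos (node o φ ψ)

data Label (V P : Set) : Set where
  input : V → Label V P
  gate  : Op → P → P → Label V P

mapLabel : ∀ {P Q : Set} → (P → Q) → Label V P → Label V Q
mapLabel h (input x)    = input x
mapLabel h (gate o p q) = gate o (h p) (h q)

toNodeLabel : ∀ {P : Set} {k} → (P → Fin k) → Label V P → NodeLabel V k
toNodeLabel h (input x)    = input x
toNodeLabel h (gate o p q) = gate o (h p) (h q)

label : {φ : Formula V} → Pos φ → Label V (Pos φ)
label {φ = leaf x}     root      = input x
label {φ = node o φ ψ} root      = gate o (left root) (right root)
label                  (left p)  = mapLabel left (label p)
label                  (right p) = mapLabel right (label p)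

subformula : {φ : Formula V} → Pos φ → Formula V
subformula {φ = φ} root = φ
subformula (left p)     = subformula p
subformula (right p)    = subformula p

size : Formula V → ℕ
size (leaf x)     = 1
size (node o φ ψ) = (size φ + size ψ) + 1

-- Post-order numbering, so that every gate comes after its predecessors.
index : {φ : Formula V} → Pos φ → Fin (size φ)
index {φ = leaf x}     root              = zero
index {φ = node o φ ψ} root              = (size φ + size ψ) ↑ʳ zero
index {φ = node o φ ψ} (left p)          = (index p ↑ˡ size ψ) ↑ˡ 1
index {φ = node o φ ψ} (right p)         = (size φ ↑ʳ index p) ↑ˡ 1

position : (φ : Formula V) → Fin (size φ) → Pos φ
position (leaf x) i = root
position (node o φ ψ) i with splitAt (size φ + size ψ) i
... | inj₂ _ = root
... | inj₁ j with splitAt (size φ) j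
...   | inj₁ k = left (position φ k)
...   | inj₂ k = right (position ψ k)

position-index : {φ : Formula V} (p : Pos φ) → position φ (index p) ≡ p
position-index {φ = leaf x} root = refl
position-index {φ = node o φ ψ} root
  rewrite splitAt-↑ʳ (size φ + size ψ) 1 zero = refl
position-index {φ = node o φ ψ} (left p)
  rewrite splitAt-↑ˡ (size φ + size ψ) (index p ↑ˡ size ψ) 1
        | splitAt-↑ˡ (size φ) (index p) (size ψ) = cong left (position-index p)
position-index {φ = node o φ ψ} (right p)
  rewrite splitAt-↑ˡ (size φ + size ψ) (size φ ↑ʳ index p) 1
        | splitAt-↑ʳ (size φ) (size ψ) (index p) = cong right (position-index p)

index-position : (φ : Formula V) (i : Fin (size φ)) → index (position φ i) ≡ i
index-position (leaf x) zero = refl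
index-position (node o φ ψ) i with splitAt (size φ + size ψ) i in eq
... | inj₂ zero = splitAt⁻¹-↑ʳ eq
... | inj₁ j with splitAt (size φ) j in eq′
...   | inj₁ k = trans (cong (λ l → (l ↑ˡ size ψ) ↑ˡ 1) (index-position φ k))
                  (trans (cong (_↑ˡ 1) (splitAt⁻¹-↑ˡ eq′)) (splitAt⁻¹-↑ˡ eq))
...   | inj₂ k = trans (cong (λ l → (size φ ↑ʳ l) ↑ˡ 1) (index-position ψ k))
                  (trans (cong (_↑ˡ 1) (splitAt⁻¹-↑ʳ eq′)) (splitAt⁻¹-↑ˡ eq))

toℕ-left : ∀ {o} {φ ψ : Formula V} (p : Pos φ) → toℕ (index (left {o = o} {ψ = ψ} p)) ≡ toℕ (index p)
toℕ-left {ψ = ψ} p = trans (toℕ-↑ˡ (index p ↑ˡ size ψ) 1) (toℕ-↑ˡ (index p) (size ψ))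

toℕ-right : ∀ {o} {φ ψ : Formula V} (p : Pos ψ) →
  toℕ (index (right {o = o} {φ = φ} p)) ≡ size φ + toℕ (index p)
toℕ-right {φ = φ} p = trans (toℕ-↑ˡ (size φ ↑ʳ index p) 1) (toℕ-↑ʳ (size φ) (index p))

toℕ-root : ∀ {o} {φ ψ : Formula V} → toℕ (index {φ = node o φ ψ} root) ≡ size φ + size ψ
toℕ-root {φ = φ} {ψ} = trans (toℕ-↑ʳ (size φ + size ψ) zero) (+-identityʳ _)

label-decreasing : {φ : Formula V} (p : Pos φ) {o : Op} {q r : Pos φ} → label p ≡ gate o q r →
  toℕ (index q) < toℕ (index p) × toℕ (index r) < toℕ (index p)
label-decreasing {φ = leaf x} root ()
label-decreasing {φ = node o φ ψ} root refl
  rewrite toℕ-root {o = o} {φ} {ψ} | toℕ-left {o = o} {φ} {ψ} root | toℕ-right {o = o} {φ} {ψ} root =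
  ≤-trans (toℕ<n (index {φ = φ} root)) (m≤m+n _ _) , +-monoʳ-< (size φ) (toℕ<n (index {φ = ψ} root))
label-decreasing {φ = node o φ ψ} (left p) eq with label p in eq′
label-decreasing {φ = node o φ ψ} (left p) refl | gate _ q r
  rewrite toℕ-left {o = o} {φ} {ψ} p | toℕ-left {o = o} {φ} {ψ} q | toℕ-left {o = o} {φ} {ψ} r =
  label-decreasing p eq′
label-decreasing {φ = node o φ ψ} (right p) eq with label p in eq′
label-decreasing {φ = node o φ ψ} (right p) refl | gate _ q r
  rewrite toℕ-right {o = o} {φ} {ψ} p | toℕ-right {o = o} {φ} {ψ} q | toℕ-right {o = o} {φ} {ψ} r =
  let (q<p , r<p) = label-decreasing p eq′ in +-monoʳ-< (size φ) q<p , +-monoʳ-< (size φ) r<p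

label-delay : (a : V → ℕ) {φ : Formula V} (p : Pos φ) {o : Op} {q r : Pos φ} → label p ≡ gate o q r →
  delay a (subformula q) < delay a (subformula p) × delay a (subformula r) < delay a (subformula p)
label-delay a {leaf x} root ()
label-delay a {node o φ ψ} root refl = s≤s (m≤m⊔n _ _) , s≤s (m≤n⊔m _ _)
label-delay a {node o φ ψ} (left p) eq with label p in eq′
label-delay a {node o φ ψ} (left p) refl | gate _ q r = label-delay a p eq′
label-delay a {node o φ ψ} (right p) eq with label p in eq′
label-delay a {node o φ ψ} (right p) refl | gate _ q r = label-delay a p eq′

label-input : {φ : Formula V} (p : Pos φ) {x : V} → label p ≡ input x → subformula p ≡ leaf x
label-input {φ = leaf x} root refl = refl
label-input (left p) eq with label p in eq′
label-input (left p) refl | input x = label-input p eq′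
label-input (right p) eq with label p in eq′
label-input (right p) refl | input x = label-input p eq′

parent : {φ : Formula V} (p : Pos φ) →
  p ≡ root ⊎ ∃ λ q → ∃ λ o → ∃ λ r → label q ≡ gate o p r ⊎ label q ≡ gate o r p
parent root = inj₁ refl
parent (left p) with parent p
... | inj₁ refl                     = inj₂ (root , _ , _ , inj₁ refl)
... | inj₂ (q , o , r , inj₁ eq) = inj₂ (left q , o , left r , inj₁ (cong (mapLabel left) eq))
... | inj₂ (q , o , r , inj₂ eq) = inj₂ (left q , o , left r , inj₂ (cong (mapLabel left) eq))
parent (right p) with parent p
... | inj₁ refl                     = inj₂ (root , _ , _ , inj₂ refl)
... | inj₂ (q , o , r , inj₁ eq) = inj₂ (right q , o , right r , inj₁ (cong (mapLabel right) eq))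
... | inj₂ (q , o , r , inj₂ eq) = inj₂ (right q , o , right r , inj₂ (cong (mapLabel right) eq))

subformula-delay-≤ : (a : V → ℕ) {φ : Formula V} (p : Pos φ) → delay a (subformula p) ≤ delay a φ
subformula-delay-≤ a root                  = ≤-refl
subformula-delay-≤ a {node o φ ψ} (left p)  = ≤-trans (subformula-delay-≤ a p) (≤-trans (m≤m⊔n _ _) (n≤1+n _))
subformula-delay-≤ a {node o φ ψ} (right p) = ≤-trans (subformula-delay-≤ a p) (≤-trans (m≤n⊔m _ _) (n≤1+n _))

module _ (φ : Formula V) where

  nodeOf : Fin (size φ) → NodeLabel V (size φ)
  nodeOf i = toNodeLabel index (label (position φ i))

  nodeOf-index : (p : Pos φ) → nodeOf (index p) ≡ toNodeLabel index (label p)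
  nodeOf-index p = cong (λ q → toNodeLabel index (label q)) (position-index p)

  nodeOf-gate : ∀ i {o j l} → nodeOf i ≡ gate o j l →
    ∃ λ q → ∃ λ r → label (position φ i) ≡ gate o q r × index q ≡ j × index r ≡ l
  nodeOf-gate i eq with label (position φ i)
  nodeOf-gate i refl | gate o q r = q , r , refl , refl , refl

  nodeOf-input : ∀ i {x} → nodeOf i ≡ input x → label (position φ i) ≡ input x
  nodeOf-input i eq with label (position φ i)
  nodeOf-input i refl | input x = refl

  acyclicOf : ∀ i o j l → nodeOf i ≡ gate o j l → toℕ j < toℕ i × toℕ l < toℕ i
  acyclicOf i o j l eq with nodeOf-gate i eq
  ... | q , r , leq , refl , refl =
    subst (λ k → toℕ (index q) < toℕ k × toℕ (index r) < toℕ k) (index-position φ i)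
      (label-decreasing (position φ i) leq)

  onlySinkOf : ∀ u → u ≡ index (root {φ = φ}) ⊎
    ∃ λ v → ∃ λ o → ∃ λ l → nodeOf v ≡ gate o u l ⊎ nodeOf v ≡ gate o l u
  onlySinkOf u with parent (position φ u)
  ... | inj₁ eq = inj₁ (trans (sym (index-position φ u)) (cong index eq))
  ... | inj₂ (q , o , r , inj₁ eq) = inj₂ (index q , o , index r , inj₁
          (trans (nodeOf-index q) (trans (cong (toNodeLabel index) eq)
            (cong (λ k → gate o k (index r)) (index-position φ u)))))
  ... | inj₂ (q , o , r , inj₂ eq) = inj₂ (index q , o , index r , inj₂
          (trans (nodeOf-index q) (trans (cong (toNodeLabel index) eq)
            (cong (λ k → gate o (index r) k) (index-position φ u)))))

  toCircuit : Circuit V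
  toCircuit = record
    { size     = size φ
    ; node     = nodeOf
    ; out      = index (root {φ = φ})
    ; acyclic  = acyclicOf
    ; onlySink = onlySinkOf
    }

  open Circuit toCircuit using (Edge; Path; stop; step; isGate; Consistent; Realizes; DelayAtMost)

  module _ (α : V → Bool) (val : Fin (size φ) → Bool) (con : Consistent α val) where

    consistent-input : ∀ u {x} → nodeOf u ≡ input x → val u ≡ α x
    consistent-input u eq with nodeOf u | con u
    consistent-input u refl | _ | c = c

    consistent-gate : ∀ u {o j l} → nodeOf u ≡ gate o j l → val u ≡ ⟦ o ⟧ (val j) (val l)
    consistent-gate u eq with nodeOf u | con u
    consistent-gate u refl | _ | c = c

    -- Induction on `φ` itself would lose the circuit in which `val` is consistent. The circuit is
    -- therefore kept fixed, and the induction runs over formulas `ψ` embedded in it by `ι`.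
    consistent-eval : ∀ ψ (ι : Pos ψ → Fin (size φ)) →
      (∀ p → nodeOf (ι p) ≡ toNodeLabel ι (label p)) → val (ι root) ≡ eval ψ α
    consistent-eval (leaf x) ι emb = consistent-input (ι root) (emb root)
    consistent-eval (node o ψ χ) ι emb =
      trans (consistent-gate (ι root) (emb root))
        (cong₂ ⟦ o ⟧
          (consistent-eval ψ (λ p → ι (left p)) (λ p → trans (emb (left p)) (mapped left (label p))))
          (consistent-eval χ (λ p → ι (right p)) (λ p → trans (emb (right p)) (mapped right (label p)))))
      where
      mapped : ∀ {P} (h : P → Pos (node o ψ χ)) (ℓ : Label V P) →
        toNodeLabel ι (mapLabel h ℓ) ≡ toNodeLabel (λ p → ι (h p)) ℓ
      mapped h (input x)    = refl
      mapped h (gate _ _ _) = refl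

  toCircuit-realizes : Realizes (eval φ)
  toCircuit-realizes α val con = consistent-eval α val con φ index nodeOf-index

  isGate-gate : ∀ u {o j l} → nodeOf u ≡ gate o j l → isGate u ≡ 1
  isGate-gate u eq with nodeOf u
  isGate-gate u refl | gate _ _ _ = refl

  isGate-input : ∀ u {x} → nodeOf u ≡ input x → isGate u ≡ 0
  isGate-input u eq with nodeOf u
  isGate-input u refl | input _ = refl

  module _ (a : V → ℕ) where

    delayAt : Fin (size φ) → ℕ
    delayAt i = delay a (subformula (position φ i))

    edge-delay : ∀ {u v} → Edge u v → delayAt u < delayAt v × isGate v ≡ 1
    edge-delay {u} {v} (o , l , inj₁ eq) with nodeOf-gate v eq
    ... | q , r , leq , refl , refl =
      subst (λ p → delay a (subformula p) < delayAt v) (sym (position-index q))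
        (proj₁ (label-delay a (position φ v) leq))
      , isGate-gate v eq
    edge-delay {u} {v} (o , l , inj₂ eq) with nodeOf-gate v eq
    ... | q , r , leq , refl , refl =
      subst (λ p → delay a (subformula p) < delayAt v) (sym (position-index r))
        (proj₂ (label-delay a (position φ v) leq))
      , isGate-gate v eq

    -- Each edge raises `delayAt` by at least one, which pays for the gate it enters. The first node
    -- is entered by no edge, hence `isGate u` on the right; it vanishes at inputs, where the bound
    -- is used.
    path-delay : ∀ {u c} → Path u c → delayAt u + c ≤ delay a φ + isGate u
    path-delay {u} stop = +-monoˡ-≤ (isGate u) (subformula-delay-≤ a (position φ u))
    path-delay {u} (step {v = v} {c} e p) with edge-delay e | path-delay p
    ... | lt , one | ih rewrite one = begin
      delayAt u + (isGate u + c)  ≡⟨ cong (delayAt u +_) (+-comm (isGate u) c) ⟩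
      delayAt u + (c + isGate u)  ≡⟨ +-assoc (delayAt u) c (isGate u) ⟨
      delayAt u + c + isGate u    ≤⟨ +-monoˡ-≤ (isGate u) (≤-pred (≤-trans (+-monoˡ-≤ c lt) ih′)) ⟩
      delay a φ + isGate u        ∎
      where
      open ≤-Reasoning
      ih′ = ≤-trans ih (≤-reflexive (+-comm (delay a φ) 1))

    toCircuit-delay : DelayAtMost a (delay a φ)
    toCircuit-delay u x eq c p = begin
      a x + c               ≡⟨ cong (λ ψ → delay a ψ + c) (label-input (position φ u) (nodeOf-input u eq)) ⟨
      delayAt u + c         ≤⟨ path-delay p ⟩
      delay a φ + isGate u  ≡⟨ cong (delay a φ +_) (isGate-input u eq) ⟩
      delay a φ + 0         ≡⟨ +-identityʳ _ ⟩
      delay a φ             ∎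
      where open ≤-Reasoning

-- Powers, the two operators, weights and folds

^-cancelʳ-≤ : ∀ b {m n} → 1 < b → b ^ m ≤ b ^ n → m ≤ n
^-cancelʳ-≤ b 1<b le = ≮⇒≥ λ n<m → <⇒≱ (^-monoʳ-< b 1<b n<m) le

^-cancelʳ-< : ∀ b {m n} → 1 < b → b ^ m < b ^ n → m < n
^-cancelʳ-< b@(suc _) 1<b lt = ≰⇒> λ n≤m → <⇒≱ lt (^-monoʳ-≤ b n≤m)

double : ∀ n → n + n ≡ 2 * n
double n = cong (n +_) (sym (+-identityʳ n))

dual : Op → Op
dual AND = OR
dual OR  = AND

unit : Op → Bool
unit AND = true
unit OR  = false

⟦⟧-assoc : ∀ o x y z → ⟦ o ⟧ (⟦ o ⟧ x y) z ≡ ⟦ o ⟧ x (⟦ o ⟧ y z)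
⟦⟧-assoc AND = ∧-assoc
⟦⟧-assoc OR  = ∨-assoc

⟦⟧-comm : ∀ o x y → ⟦ o ⟧ x y ≡ ⟦ o ⟧ y x
⟦⟧-comm AND = ∧-comm
⟦⟧-comm OR  = ∨-comm

⟦⟧-identityʳ : ∀ o x → ⟦ o ⟧ x (unit o) ≡ x
⟦⟧-identityʳ AND = ∧-identityʳ
⟦⟧-identityʳ OR  = ∨-identityʳ

⟦⟧-dual-distribˡ : ∀ o x y z → ⟦ dual o ⟧ x (⟦ o ⟧ y z) ≡ ⟦ o ⟧ (⟦ dual o ⟧ x y) (⟦ dual o ⟧ x z)
⟦⟧-dual-distribˡ AND = ∨-distribˡ-∧
⟦⟧-dual-distribˡ OR  = ∧-distribˡ-∨

⟦⟧-left-comm : ∀ o x y z → ⟦ o ⟧ x (⟦ o ⟧ y z) ≡ ⟦ o ⟧ y (⟦ o ⟧ x z)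
⟦⟧-left-comm o x y z = begin
  ⟦ o ⟧ x (⟦ o ⟧ y z)  ≡⟨ ⟦⟧-assoc o x y z ⟨
  ⟦ o ⟧ (⟦ o ⟧ x y) z  ≡⟨ cong (λ b → ⟦ o ⟧ b z) (⟦⟧-comm o x y) ⟩
  ⟦ o ⟧ (⟦ o ⟧ y x) z  ≡⟨ ⟦⟧-assoc o y x z ⟩
  ⟦ o ⟧ y (⟦ o ⟧ x z)  ∎
  where open ≡-Reasoning

weight : {A : Set} → (A → ℕ) → List A → ℕ
weight a = foldr (λ x r → 2 ^ a x + r) 0

weight-++ : {A : Set} (a : A → ℕ) (l l′ : List A) → weight a (l ++ l′) ≡ weight a l + weight a l′
weight-++ a []      l′ = refl
weight-++ a (x ∷ l) l′ = trans (cong (2 ^ a x +_) (weight-++ a l l′)) (sym (+-assoc (2 ^ a x) _ _))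

reduce : {A : Set} → Op → (A → Bool) → List A → Bool → Bool
reduce o h l b = foldr (λ x → ⟦ o ⟧ (h x)) b l

-- Associativity lets the factor `c` leave the fold, so that it can be realized by a circuit of its
-- own.
reduce-⟦⟧ : {A : Set} (o : Op) (h : A → Bool) (l : List A) (b c : Bool) →
  reduce o h l (⟦ o ⟧ b c) ≡ ⟦ o ⟧ (reduce o h l b) c
reduce-⟦⟧ o h []      b c = refl
reduce-⟦⟧ o h (x ∷ l) b c =
  trans (cong (⟦ o ⟧ (h x)) (reduce-⟦⟧ o h l b c)) (sym (⟦⟧-assoc o (h x) _ c))

Within : (V → ℕ) → ℕ → ((V → Bool) → Bool) → Set
Within a d F = ∃ λ φ → delay a φ ≤ d × (∀ α → eval φ α ≡ F α)

-- Huffman coding by means of a binary counter: the digit at position i is a formula of delay at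
-- most i, and inserting a formula of delay k adds 2 ^ k, a carry being one gate.
module _ (a : V → ℕ) (o : Op) where

  data Counter : ℕ → Set where
    []   : ∀ {i} → Counter i
    skip : ∀ {i} → Counter (suc i) → Counter i
    put  : ∀ {i} φ → delay a φ ≤ i → Counter (suc i) → Counter i

  value : ∀ {i} → Counter i → ℕ
  value []            = 0
  value (skip c)      = value c
  value {i} (put φ _ c) = 2 ^ i + value c

  digits : ∀ {i} → Counter i → List (Formula V)
  digits []          = []
  digits (skip c)    = digits c
  digits (put φ _ c) = φ ∷ digits c

  -- `Counter i` holds the digits from position `i` upwards, and `k` is the distance from there to
  -- the position of insertion.
  insert : ∀ k {i} φ → delay a φ ≤ k + i → Counter i → Counter i
  insert zero    φ p []          = put φ p []
  insert zero    φ p (skip c)    = put φ p c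
  insert zero    φ p (put ψ q c) = skip (insert zero (node o φ ψ) (s≤s (⊔-lub p q)) c)
  insert (suc k) {i} φ p []          = skip (insert k φ (≤-trans p (≤-reflexive (sym (+-suc k i)))) [])
  insert (suc k) {i} φ p (skip c)    = skip (insert k φ (≤-trans p (≤-reflexive (sym (+-suc k i)))) c)
  insert (suc k) {i} φ p (put ψ q c) = put ψ q (insert k φ (≤-trans p (≤-reflexive (sym (+-suc k i)))) c)

  value-insert : ∀ k {i} φ p (c : Counter i) → value (insert k φ p c) ≡ 2 ^ (k + i) + value c
  value-insert zero φ p []         = refl
  value-insert zero φ p (skip c)   = refl
  value-insert zero {i} φ p (put ψ q c) = begin
    value (insert zero (node o φ ψ) _ c)  ≡⟨ value-insert zero (node o φ ψ) _ c ⟩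
    2 * 2 ^ i + value c                   ≡⟨ cong (_+ value c) (double (2 ^ i)) ⟨
    2 ^ i + 2 ^ i + value c               ≡⟨ +-assoc (2 ^ i) (2 ^ i) (value c) ⟩
    2 ^ i + (2 ^ i + value c)             ∎
    where open ≡-Reasoning
  value-insert (suc k) {i} φ p [] =
    trans (value-insert k φ _ []) (cong (λ e → 2 ^ e + 0) (+-suc k i))
  value-insert (suc k) {i} φ p (skip c) =
    trans (value-insert k φ _ c) (cong (λ e → 2 ^ e + value c) (+-suc k i))
  value-insert (suc k) {i} φ p (put ψ q c) = begin
    2 ^ i + value (insert k φ _ c)         ≡⟨ cong (2 ^ i +_) (value-insert k φ _ c) ⟩
    2 ^ i + (2 ^ (k + suc i) + value c)    ≡⟨ cong (λ e → 2 ^ i + (2 ^ e + value c)) (+-suc k i) ⟩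
    2 ^ i + (2 ^ (suc k + i) + value c)    ≡⟨ x∙yz≈y∙xz +-commutativeSemigroup (2 ^ i) (2 ^ (suc k + i)) (value c) ⟩
    2 ^ (suc k + i) + (2 ^ i + value c)    ∎
    where open ≡-Reasoning

  module _ (α : V → Bool) where

    total : ∀ {i} → Counter i → Bool → Bool
    total c = reduce o (λ φ → eval φ α) (digits c)

    total-insert : ∀ k {i} φ p (c : Counter i) b →
      total (insert k φ p c) b ≡ ⟦ o ⟧ (eval φ α) (total c b)
    total-insert zero φ p []          b = refl
    total-insert zero φ p (skip c)    b = refl
    total-insert zero φ p (put ψ q c) b =
      trans (total-insert zero (node o φ ψ) _ c b) (⟦⟧-assoc o (eval φ α) (eval ψ α) (total c b))
    total-insert (suc k) φ p []       b = total-insert k φ _ [] b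
    total-insert (suc k) φ p (skip c) b = total-insert k φ _ c b
    total-insert (suc k) φ p (put ψ q c) b =
      trans (cong (⟦ o ⟧ (eval ψ α)) (total-insert k φ _ c b))
        (⟦⟧-left-comm o (eval ψ α) (eval φ α) (total c b))

  -- The accumulator `φ` absorbs the digit at position `i` by one gate and then has delay at most
  -- `suc i`. The strict bound on the value puts every occupied position below `d`, so the delay
  -- never exceeds `d`.
  collapse : ∀ {d i} φ → delay a φ ≤ i → delay a φ ≤ d → (c : Counter i) → value c < 2 ^ d →
    Within a d (λ α → total α c (eval φ α))
  collapse φ p q []       lt = φ , q , λ _ → refl
  collapse φ p q (skip c) lt = collapse φ (m≤n⇒m≤1+n p) q c lt
  collapse {d} {i} φ p q (put ψ r c) lt
    with collapse (node o φ ψ) (s≤s (⊔-lub p r)) (≤-trans (s≤s (⊔-lub p r)) i<d) c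
           (≤-<-trans (m≤n+m (value c) (2 ^ i)) lt)
    where
    i<d : i < d
    i<d = ^-cancelʳ-< 2 ≤-refl (≤-<-trans (m≤m+n (2 ^ i) (value c)) lt)
  ... | χ , le , eq = χ , le , λ α → begin
    eval χ α                                       ≡⟨ eq α ⟩
    total α c (⟦ o ⟧ (eval φ α) (eval ψ α))        ≡⟨ reduce-⟦⟧ o _ (digits c) _ _ ⟩
    ⟦ o ⟧ (total α c (eval φ α)) (eval ψ α)        ≡⟨ ⟦⟧-comm o _ _ ⟩
    ⟦ o ⟧ (eval ψ α) (total α c (eval φ α))        ∎
    where open ≡-Reasoning

  collapse-all : ∀ {d i} (c : Counter i) → 0 < value c → value c ≤ 2 ^ d →
    Within a d (λ α → total α c (unit o))
  collapse-all [] () le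
  collapse-all (skip c) pos le = collapse-all c pos le
  collapse-all {d} {i} (put φ p c) pos le
    -- The lowest digit starts the accumulator. Its weight is positive, so the other digits have
    -- value strictly below `2 ^ d`.
    with collapse φ (m≤n⇒m≤1+n p) (≤-trans p i≤d) c (≤-trans (+-monoˡ-≤ (value c) (m^n>0 2 i)) le)
    where
    i≤d : i ≤ d
    i≤d = ^-cancelʳ-≤ 2 ≤-refl (≤-trans (m≤m+n (2 ^ i) (value c)) le)
  ... | χ , le′ , eq = χ , le′ , λ α → begin
    eval χ α                                ≡⟨ eq α ⟩
    total α c (eval φ α)                    ≡⟨ cong (total α c) (⟦⟧-identityʳ o (eval φ α)) ⟨
    total α c (⟦ o ⟧ (eval φ α) (unit o))   ≡⟨ cong (total α c) (⟦⟧-comm o _ _) ⟩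
    total α c (⟦ o ⟧ (unit o) (eval φ α))   ≡⟨ reduce-⟦⟧ o _ (digits c) _ _ ⟩
    ⟦ o ⟧ (total α c (unit o)) (eval φ α)   ≡⟨ ⟦⟧-comm o _ _ ⟩
    ⟦ o ⟧ (eval φ α) (total α c (unit o))   ∎
    where open ≡-Reasoning

  fromFormulas : List (Formula V) → Counter 0
  fromFormulas []      = []
  fromFormulas (φ ∷ l) = insert (delay a φ) φ (m≤m+n _ 0) (fromFormulas l)

  value-fromFormulas : ∀ l → value (fromFormulas l) ≡ weight (delay a) l
  value-fromFormulas []      = refl
  value-fromFormulas (φ ∷ l) = trans (value-insert (delay a φ) φ _ (fromFormulas l))
    (cong₂ (λ e r → 2 ^ e + r) (+-identityʳ (delay a φ)) (value-fromFormulas l))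

  total-fromFormulas : ∀ l α b → total α (fromFormulas l) b ≡ reduce o (λ φ → eval φ α) l b
  total-fromFormulas []      α b = refl
  total-fromFormulas (φ ∷ l) α b = trans (total-insert α (delay a φ) φ _ (fromFormulas l) b)
    (cong (⟦ o ⟧ (eval φ α)) (total-fromFormulas l α b))

  huffman : ∀ {d} s φ → weight a s + 2 ^ delay a φ ≤ 2 ^ d →
    Within a d (λ α → reduce o α s (eval φ α))
  huffman {d} s φ le with collapse-all {d} (fromFormulas l) positive bounded
    where
    l = map leaf s ++ φ ∷ []
    weight-l : value (fromFormulas l) ≡ weight a s + 2 ^ delay a φ
    weight-l = begin
      value (fromFormulas l)                              ≡⟨ value-fromFormulas l ⟩
      weight (delay a) l                                  ≡⟨ weight-++ (delay a) (map leaf s) (φ ∷ []) ⟩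
      weight (delay a) (map leaf s) + (2 ^ delay a φ + 0) ≡⟨ cong₂ _+_ (foldr-map _ leaf 0 s) (+-identityʳ _) ⟩
      weight a s + 2 ^ delay a φ                          ∎
      where open ≡-Reasoning
    positive : 0 < value (fromFormulas l)
    positive = ≤-trans (≤-trans (m^n>0 2 (delay a φ)) (m≤n+m _ _)) (≤-reflexive (sym weight-l))
    bounded : value (fromFormulas l) ≤ 2 ^ d
    bounded = ≤-trans (≤-reflexive weight-l) le
  ... | χ , le′ , eq = χ , le′ , λ α → begin
    eval χ α                                                        ≡⟨ eq α ⟩
    total α (fromFormulas l) (unit o)                               ≡⟨ total-fromFormulas l α (unit o) ⟩
    reduce o (λ ψ → eval ψ α) l (unit o)                            ≡⟨ foldr-++ _ (unit o) (map leaf s) (φ ∷ []) ⟩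
    reduce o (λ ψ → eval ψ α) (map leaf s) (⟦ o ⟧ (eval φ α) (unit o))  ≡⟨ foldr-map _ leaf _ s ⟩
    reduce o α s (⟦ o ⟧ (eval φ α) (unit o))                        ≡⟨ cong (reduce o α s) (⟦⟧-identityʳ o (eval φ α)) ⟩
    reduce o α s (eval φ α)                                         ∎
    where
    open ≡-Reasoning
    l = map leaf s ++ φ ∷ []

  huffman-∷ʳ : ∀ {d} s x φ → weight a s + 2 ^ a x + 2 ^ delay a φ ≤ 2 ^ d →
    Within a d (λ α → reduce o α s (⟦ o ⟧ (α x) (eval φ α)))
  huffman-∷ʳ s x φ le
    with huffman (s ++ x ∷ []) φ (≤-trans (≤-reflexive (cong (_+ 2 ^ delay a φ)
      (trans (weight-++ a s (x ∷ [])) (cong (weight a s +_) (+-identityʳ (2 ^ a x)))))) le)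
  ... | χ , le′ , eq = χ , le′ , λ α → trans (eq α) (foldr-++ _ (eval φ α) s (x ∷ []))

-- Splitting alternating paths

-- When `b` is the value of the last entry, this is `g` for `AND` and `g*` for `OR`.
alternate : {A : Set} → Op → (A → Bool) → List A → Bool → Bool
alternate o h []      b = b
alternate o h (x ∷ l) b = ⟦ o ⟧ (h x) (alternate (dual o) h l b)

-- The hypothesis covers both operators because the length of `k` decides which one is reached.
alternate-++-cong : {A : Set} (o : Op) (h : A → Bool) (k : List A) {l l′ : List A} {b b′ : Bool} →
  (∀ o → alternate o h l b ≡ alternate o h l′ b′) →
  alternate o h (k ++ l) b ≡ alternate o h (k ++ l′) b′
alternate-++-cong o h []      eq = eq o
alternate-++-cong o h (x ∷ k) eq = cong (⟦ o ⟧ (h x)) (alternate-++-cong (dual o) h k eq)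

-- Prefixes of even length are kept as pairs: the operator after such a prefix is the initial one
-- again, and the second components are the entries at odd indices.
flatten : {A : Set} → List (A × A) → List A
flatten []            = []
flatten ((x , y) ∷ p) = x ∷ y ∷ flatten p

flatten-∷ʳ : {A : Set} (p : List (A × A)) (x y : A) →
  flatten (p ++ (x , y) ∷ []) ≡ (flatten p ++ x ∷ []) ++ y ∷ []
flatten-∷ʳ []      x y = refl
flatten-∷ʳ (_ ∷ p) x y = cong (λ l → _ ∷ _ ∷ l) (flatten-∷ʳ p x y)

flatten-∷ʳ-++ : {A : Set} (p : List (A × A)) (x y : A) (l : List A) →
  flatten (p ++ (x , y) ∷ []) ++ l ≡ flatten p ++ x ∷ y ∷ l
flatten-∷ʳ-++ []      x y l = refl
flatten-∷ʳ-++ (_ ∷ p) x y l = cong (λ l → _ ∷ _ ∷ l) (flatten-∷ʳ-++ p x y l)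

weight-flatten-∷ʳ : {A : Set} (a : A → ℕ) (p : List (A × A)) (x y : A) →
  weight a (flatten (p ++ (x , y) ∷ [])) ≡ weight a (flatten p) + 2 ^ a x + 2 ^ a y
weight-flatten-∷ʳ a p x y = begin
  weight a (flatten (p ++ (x , y) ∷ []))               ≡⟨ cong (weight a) (flatten-∷ʳ p x y) ⟩
  weight a ((flatten p ++ x ∷ []) ++ y ∷ [])           ≡⟨ weight-++ a (flatten p ++ x ∷ []) (y ∷ []) ⟩
  weight a (flatten p ++ x ∷ []) + (2 ^ a y + 0)       ≡⟨ cong₂ _+_ (weight-++ a (flatten p) (x ∷ [])) (+-identityʳ _) ⟩
  weight a (flatten p) + (2 ^ a x + 0) + 2 ^ a y       ≡⟨ cong (λ k → weight a (flatten p) + k + 2 ^ a y) (+-identityʳ _) ⟩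
  weight a (flatten p) + 2 ^ a x + 2 ^ a y             ∎
  where open ≡-Reasoning

weight-seconds-≤ : {A : Set} (a : A → ℕ) (p : List (A × A)) →
  weight a (map proj₂ p) ≤ weight a (flatten p)
weight-seconds-≤ a []            = z≤n
weight-seconds-≤ a ((x , y) ∷ p) =
  ≤-trans (+-monoʳ-≤ (2 ^ a y) (weight-seconds-≤ a p)) (m≤n+m _ (2 ^ a x))

-- x₀ ∧ (y₀ ∨ (x₁ ∧ (y₁ ∨ … (u ∧ c)))) = (x₀ ∧ (y₀ ∨ … u)) ∧ (y₀ ∨ y₁ ∨ … ∨ c)
alternate-split : {A : Set} (o : Op) (h : A → Bool) (p : List (A × A)) (u : A) (l : List A) (b : Bool) →
  alternate o h (flatten p ++ u ∷ l) b ≡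
  ⟦ o ⟧ (alternate o h (flatten p) (h u)) (reduce (dual o) h (map proj₂ p) (alternate (dual o) h l b))
alternate-split o h []            u l b = refl
alternate-split o h ((x , y) ∷ p) u l b = begin
  ⟦ o ⟧ (h x) (⟦ dual o ⟧ (h y) (alternate (dual (dual o)) h (flatten p ++ u ∷ l) b))
    ≡⟨ cong (λ o′ → ⟦ o ⟧ (h x) (⟦ dual o ⟧ (h y) (alternate o′ h (flatten p ++ u ∷ l) b))) (dual-involutive o) ⟩
  ⟦ o ⟧ (h x) (⟦ dual o ⟧ (h y) (alternate o h (flatten p ++ u ∷ l) b))
    ≡⟨ cong (λ c → ⟦ o ⟧ (h x) (⟦ dual o ⟧ (h y) c)) (alternate-split o h p u l b) ⟩
  ⟦ o ⟧ (h x) (⟦ dual o ⟧ (h y) (⟦ o ⟧ A B))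
    ≡⟨ cong (⟦ o ⟧ (h x)) (⟦⟧-dual-distribˡ o (h y) A B) ⟩
  ⟦ o ⟧ (h x) (⟦ o ⟧ (⟦ dual o ⟧ (h y) A) (⟦ dual o ⟧ (h y) B))
    ≡⟨ ⟦⟧-assoc o _ _ _ ⟨
  ⟦ o ⟧ (⟦ o ⟧ (h x) (⟦ dual o ⟧ (h y) A)) (⟦ dual o ⟧ (h y) B)
    ≡⟨ cong (λ o′ → ⟦ o ⟧ (⟦ o ⟧ (h x) (⟦ dual o ⟧ (h y) (alternate o′ h (flatten p) (h u)))) (⟦ dual o ⟧ (h y) B))
         (dual-involutive o) ⟨
  ⟦ o ⟧ (⟦ o ⟧ (h x) (⟦ dual o ⟧ (h y) (alternate (dual (dual o)) h (flatten p) (h u)))) (⟦ dual o ⟧ (h y) B)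
    ∎
  where
  open ≡-Reasoning
  A = alternate o h (flatten p) (h u)
  B = reduce (dual o) h (map proj₂ p) (alternate (dual o) h l b)
  dual-involutive : ∀ o → dual (dual o) ≡ o
  dual-involutive AND = refl
  dual-involutive OR  = refl

-- For `AND` this is f(s, t), where t consists of `l` and the last entry `z`; for `OR` it is the
-- dual f*.
path : {A : Set} → Op → List A → List A → A → (A → Bool) → Bool
path o s l z h = reduce o h s (alternate o h l (h z))

-- Both factors are again of the form `path`, the second one for the dual operator, so the induction
-- has to treat both operators at once.
path-split : {A : Set} (o : Op) (s : List A) (p : List (A × A)) (u : A) (l : List A) (z : A) (h : A → Bool) →
  path o s (flatten p ++ u ∷ l) z h ≡ ⟦ o ⟧ (path o s (flatten p) u h) (path (dual o) (map proj₂ p) l z h)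
path-split o s p u l z h =
  trans (cong (reduce o h s) (alternate-split o h p u l (h z))) (reduce-⟦⟧ o h s _ _)

-- Arithmetic of the bound

-- The bound at d = suc e, where R is the weight of all but the last two entries of t,
-- so that d · W(t) - (d - 1) · Λ = d · R + Λ.
record Fits (e w R Λ : ℕ) : Set where
  constructor mkFits
  field
    bound : (10 * (suc e * R + Λ)) ·log₂ suc e ≤ (19 * (2 ^ e ∸ w))

Fits? : ∀ e w R Λ → Dec (Fits e w R Λ)
Fits? e w R Λ = map′ mkFits Fits.bound (suc e ^ (10 * (suc e * R + Λ)) ≤? 2 ^ (19 * (2 ^ e ∸ w)))

^-mono-≤ : ∀ {m n i j} → m ≤ n → 0 < n → i ≤ j → m ^ i ≤ n ^ j
^-mono-≤ {m} {n@(suc _)} {i} m≤n _ i≤j = ≤-trans (^-monoˡ-≤ i m≤n) (^-monoʳ-≤ n i≤j)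

-- 1.9 ≤ log₂ d
2^19≤d^10 : ∀ {d} k → 4 ≤ d → 2 ^ (19 * k) ≤ d ^ (10 * k)
2^19≤d^10 {d} k 4≤d = begin
  2 ^ (19 * k)        ≤⟨ ^-monoʳ-≤ 2 (*-monoˡ-≤ k (n≤1+n 19)) ⟩
  2 ^ (20 * k)        ≡⟨ cong (2 ^_) (*-assoc 2 10 k) ⟩
  2 ^ (2 * (10 * k))  ≡⟨ ^-*-assoc 2 2 (10 * k) ⟨
  4 ^ (10 * k)        ≤⟨ ^-monoˡ-≤ (10 * k) 4≤d ⟩
  d ^ (10 * k)        ∎
  where open ≤-Reasoning

-- Uses log₂ d ≥ 1 and 1.9 ≤ 2.
Fits⇒≤2* : ∀ {e w R Λ} → 1 ≤ e → Fits e w R Λ → suc e * R + Λ ≤ 2 * (2 ^ e ∸ w)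
Fits⇒≤2* {e} {w} {R} {Λ} 1≤e (mkFits bound) = *-cancelˡ-≤ 10 (begin
  10 * X        ≤⟨ ^-cancelʳ-≤ 2 ≤-refl (≤-trans (^-monoˡ-≤ (10 * X) (s≤s 1≤e)) bound) ⟩
  19 * Y        ≤⟨ *-monoˡ-≤ Y (n≤1+n 19) ⟩
  20 * Y        ≡⟨ *-assoc 10 2 Y ⟩
  10 * (2 * Y)  ∎)
  where
  open ≤-Reasoning
  X = suc e * R + Λ
  Y = 2 ^ e ∸ w

Fits⇒≤ : ∀ {e w R Λ} → 3 ≤ e → Fits e w R Λ → suc e * R + Λ ≤ 2 ^ e ∸ w
Fits⇒≤ {e} {w} {R} {Λ} 3≤e (mkFits bound) =
  *-cancelˡ-≤ 19 (^-cancelʳ-≤ 2 ≤-refl (≤-trans (2^19≤d^10 (suc e * R + Λ) (s≤s 3≤e)) bound))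

-- If `w` fills half of the capacity, at most `2 ^ e` remains, which is the full budget one level
-- lower when `s` is empty.
Fits-pred : ∀ {e w R Λ} → 2 ^ e ≤ w → Fits (suc e) w R Λ → Fits e 0 R Λ
Fits-pred {e} {w} {R} {Λ} h≤w (mkFits bound) = mkFits (begin
  suc e ^ (10 * (suc e * R + Λ))
    ≤⟨ ^-mono-≤ (n≤1+n _) (s≤s z≤n) (*-monoʳ-≤ 10 (+-monoˡ-≤ Λ (m≤n+m (suc e * R) R))) ⟩
  suc (suc e) ^ (10 * (suc (suc e) * R + Λ))
    ≤⟨ bound ⟩
  2 ^ (19 * (2 * 2 ^ e ∸ w))
    ≤⟨ ^-monoʳ-≤ 2 (*-monoʳ-≤ 19 (∸-monoʳ-≤ (2 * 2 ^ e) h≤w)) ⟩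
  2 ^ (19 * (2 * 2 ^ e ∸ 2 ^ e))
    ≡⟨ cong (λ k → 2 ^ (19 * k)) (trans (cong (_∸ 2 ^ e) (sym (double (2 ^ e)))) (m+n∸n≡m (2 ^ e) (2 ^ e))) ⟩
  2 ^ (19 * 2 ^ e)
    ∎)
  where open ≤-Reasoning

2h∸w : ∀ {h w} → w ≤ h → 2 * h ∸ w ≡ h + (h ∸ w)
2h∸w {h} {w} w≤h = trans (cong (_∸ w) (sym (double h))) (+-∸-assoc h w≤h)

-- P is the weight of the prefix, Q that of the two entries after it, and w′ that of the entries of
-- the prefix which join the other factor. In d (P + R) = (d - 1) P + (d - 1) R + P + R the spare P
-- pays for w′ and the spare R for Q.
Fits-suffix : ∀ {e w w′ P R Q Λ} → 3 ≤ e → w ≤ 2 ^ e → ¬ Fits e w P Q → Q ≤ R → w′ ≤ P → w′ ≤ 2 ^ e →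
  Fits (suc e) w (P + R) Λ → Fits e w′ R Λ
Fits-suffix {e} {w} {w′} {P} {R} {Q} {Λ} 3≤e w≤h unfit Q≤R w′≤P w′≤h (mkFits bound) =
  -- Exponents are subtracted by cancelling `C`. Its first factor is bounded by the violated prefix
  -- bound, its second by 1.9 ≤ log₂ D together with `w′ ≤ P`.
  mkFits (*-cancelʳ-≤ _ _ C {{m*n≢0 _ _ {{m^n≢0 2 (19 * (h ∸ w))}} {{m^n≢0 2 (19 * w′)}}}} (begin
  D ^ (10 * (D * R + Λ)) * C
    ≤⟨ *-monoʳ-≤ (D ^ (10 * (D * R + Λ))) (*-mono-≤ (<⇒≤ (≰⇒> λ b → unfit (mkFits b)))
         (≤-trans (2^19≤d^10 w′ (s≤s 3≤e)) (^-monoʳ-≤ D (*-monoʳ-≤ 10 w′≤P)))) ⟩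
  D ^ (10 * (D * R + Λ)) * (D ^ (10 * (D * P + Q)) * D ^ (10 * P))
    ≡⟨ cong (D ^ (10 * (D * R + Λ)) *_) (^-distribˡ-+-* D (10 * (D * P + Q)) (10 * P)) ⟨
  D ^ (10 * (D * R + Λ)) * D ^ (10 * (D * P + Q) + 10 * P)
    ≡⟨ ^-distribˡ-+-* D (10 * (D * R + Λ)) (10 * (D * P + Q) + 10 * P) ⟨
  D ^ (10 * (D * R + Λ) + (10 * (D * P + Q) + 10 * P))
    ≤⟨ ^-monoʳ-≤ D (+-monoʳ-≤ (10 * (D * R + Λ)) (+-monoˡ-≤ (10 * P) (*-monoʳ-≤ 10 (+-monoʳ-≤ (D * P) Q≤R)))) ⟩
  D ^ (10 * (D * R + Λ) + (10 * (D * P + R) + 10 * P))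
    ≡⟨ cong (D ^_) (regroup D R Λ P) ⟩
  D ^ (10 * (suc D * (P + R) + Λ))
    ≤⟨ ^-monoˡ-≤ (10 * (suc D * (P + R) + Λ)) (n≤1+n D) ⟩
  suc D ^ (10 * (suc D * (P + R) + Λ))
    ≤⟨ bound ⟩
  2 ^ (19 * (2 * h ∸ w))
    ≡⟨ cong (λ k → 2 ^ (19 * k)) (2h∸w w≤h) ⟩
  2 ^ (19 * (h + (h ∸ w)))
    ≡⟨ cong (λ k → 2 ^ (19 * (k + (h ∸ w)))) (m∸n+n≡m w′≤h) ⟨
  2 ^ (19 * (h ∸ w′ + w′ + (h ∸ w)))
    ≡⟨ cong (2 ^_) (regroup′ (h ∸ w′) w′ (h ∸ w)) ⟩
  2 ^ (19 * (h ∸ w′) + (19 * (h ∸ w) + 19 * w′))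
    ≡⟨ ^-distribˡ-+-* 2 (19 * (h ∸ w′)) _ ⟩
  2 ^ (19 * (h ∸ w′)) * 2 ^ (19 * (h ∸ w) + 19 * w′)
    ≡⟨ cong (2 ^ (19 * (h ∸ w′)) *_) (^-distribˡ-+-* 2 (19 * (h ∸ w)) (19 * w′)) ⟩
  2 ^ (19 * (h ∸ w′)) * C
    ∎))
  where
  open ≤-Reasoning
  D = suc e
  h = 2 ^ e
  C = 2 ^ (19 * (h ∸ w)) * 2 ^ (19 * w′)
  regroup : ∀ d r l q → 10 * (d * r + l) + (10 * (d * q + r) + 10 * q) ≡ 10 * ((1 + d) * (q + r) + l)
  regroup = solve-∀
  regroup′ : ∀ i j k → 19 * (i + j + k) ≡ 19 * i + (19 * k + 19 * j)
  regroup′ = solve-∀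

-- Dropping the entry of weight `z` frees z log₂ D ≥ 1.9 h, where `D = suc e` and `h = 2 ^ e`; this
-- is what the right side loses when `2 * h ∸ w` becomes `h ∸ w`. The last two entries are then
-- those of weights `x` and `y`.
Fits-prefix : ∀ {e w P x y z} → 3 ≤ e → w ≤ 2 ^ e → 2 ^ e ≤ z →
  Fits (suc e) w (P + x) (y + z) → Fits e w P (x + y)
Fits-prefix {e} {w} {P} {x} {y} {z} 3≤e w≤h h≤z (mkFits bound) =
  mkFits (*-cancelʳ-≤ _ _ (2 ^ (19 * h)) {{m^n≢0 2 (19 * h)}} (begin
  D ^ (10 * (D * P + (x + y))) * 2 ^ (19 * h)
    ≤⟨ *-monoʳ-≤ (D ^ (10 * (D * P + (x + y)))) (≤-trans (2^19≤d^10 h (s≤s 3≤e)) (^-monoʳ-≤ D (*-monoʳ-≤ 10 h≤z))) ⟩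
  D ^ (10 * (D * P + (x + y))) * D ^ (10 * z)
    ≡⟨ ^-distribˡ-+-* D (10 * (D * P + (x + y))) (10 * z) ⟨
  D ^ (10 * (D * P + (x + y)) + 10 * z)
    ≤⟨ ^-monoʳ-≤ D (m≤m+n (10 * (D * P + (x + y)) + 10 * z) (10 * (P + D * x))) ⟩
  D ^ (10 * (D * P + (x + y)) + 10 * z + 10 * (P + D * x))
    ≡⟨ cong (D ^_) (regroup D P x y z) ⟩
  D ^ (10 * (suc D * (P + x) + (y + z)))
    ≤⟨ ^-monoˡ-≤ (10 * (suc D * (P + x) + (y + z))) (n≤1+n D) ⟩
  suc D ^ (10 * (suc D * (P + x) + (y + z)))
    ≤⟨ bound ⟩
  2 ^ (19 * (2 * h ∸ w))
    ≡⟨ cong (λ k → 2 ^ (19 * k)) (trans (2h∸w w≤h) (+-comm h (h ∸ w))) ⟩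
  2 ^ (19 * (h ∸ w + h))
    ≡⟨ cong (2 ^_) (*-distribˡ-+ 19 (h ∸ w) h) ⟩
  2 ^ (19 * (h ∸ w) + 19 * h)
    ≡⟨ ^-distribˡ-+-* 2 (19 * (h ∸ w)) (19 * h) ⟩
  2 ^ (19 * (h ∸ w)) * 2 ^ (19 * h)
    ∎))
  where
  open ≤-Reasoning
  D = suc e
  h = 2 ^ e
  regroup : ∀ d q i j k → 10 * (d * q + (i + j)) + 10 * k + 10 * (q + d * i) ≡ 10 * ((1 + d) * (q + i) + (j + k))
  regroup = solve-∀

Fits⇒R+Λ≤ : ∀ {e w R Λ} → 3 ≤ e → Fits e w R Λ → R + Λ ≤ 2 ^ e
Fits⇒R+Λ≤ {e} {w} {R} {Λ} 3≤e fits =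
  ≤-trans (+-monoˡ-≤ Λ (m≤m+n R (e * R))) (≤-trans (Fits⇒≤ 3≤e fits) (m∸n≤m (2 ^ e) w))

-- `R` is counted at least twice, and the positive `Λ` makes the inequality strict, as the weight
-- condition in `Solvable` requires.
Fits⇒R< : ∀ {e w R Λ} → 3 ≤ e → 0 < Λ → Fits (suc e) w R Λ → R < 2 ^ e
Fits⇒R< {e} {w} {R} {Λ} 3≤e 0<Λ fits = *-cancelˡ-< 2 R (2 ^ e) (begin-strict
  2 * R                   ≤⟨ *-monoˡ-≤ R (s≤s (s≤s (z≤n {e}))) ⟩
  suc (suc e) * R         <⟨ m<m+n _ 0<Λ ⟩
  suc (suc e) * R + Λ     ≤⟨ Fits⇒≤ (m≤n⇒m≤1+n 3≤e) fits ⟩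
  2 * 2 ^ e ∸ w           ≤⟨ m∸n≤m (2 * 2 ^ e) w ⟩
  2 * 2 ^ e               ∎)
  where open ≤-Reasoning

-- Realizability within a given delay

combine : ∀ {a : V → ℕ} {d F G H} o → Within a d F → Within a d G → (∀ α → H α ≡ ⟦ o ⟧ (F α) (G α)) →
  Within a (suc d) H
combine o (φ , φ≤ , φ≡) (ψ , ψ≤ , ψ≡) eq =
  node o φ ψ , s≤s (⊔-lub φ≤ ψ≤) , λ α → trans (cong₂ ⟦ o ⟧ (φ≡ α) (ψ≡ α)) (sym (eq α))

Within-cong : ∀ {a : V → ℕ} {d F G} → (∀ α → F α ≡ G α) → Within a d F → Within a d G
Within-cong eq (φ , φ≤ , φ≡) = φ , φ≤ , λ α → trans (φ≡ α) (eq α)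

-- The induction step

Solvable : (V → ℕ) → ℕ → Set
Solvable a e = ∀ o s r y z → weight a s < 2 ^ e → Fits e (weight a s) (weight a r) (2 ^ a y + 2 ^ a z) →
  Within a (suc e) (path o s (r ++ y ∷ []) z)

module _ {a : V → ℕ} {e : ℕ} (3≤e : 3 ≤ e) (ih : Solvable a e) where

  module _ (o : Op) (s : List V) (w<h : weight a s < 2 ^ e) where

    -- The prefix ends with `x` and `y`, which therefore form its Λ, while `u` joins the rest.
    extended-prefix : ∀ p u x y → Fits e (weight a s) (weight a (flatten p) + 2 ^ a u) (2 ^ a x + 2 ^ a y) →
      Within a (suc e) (path o s (flatten (p ++ (u , x) ∷ [])) y)
    extended-prefix p u x y fits =
      subst (λ l → Within a (suc e) (path o s l y)) (sym (flatten-∷ʳ p u x))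
        (ih o s (flatten p ++ u ∷ []) x y w<h
          (subst (λ R → Fits e (weight a s) R (2 ^ a x + 2 ^ a y))
            (sym (trans (weight-++ a (flatten p) (u ∷ []))
              (cong (weight a (flatten p) +_) (+-identityʳ (2 ^ a u)))))
            fits))

    -- The heavy entry `z` pays for lowering the bound of everything before it. The other factor
    -- then joins `z` and the second components by a single operator, so Huffman coding applies.
    split-off-last : ∀ p u x y z → e ≤ a z →
      Fits (suc e) (weight a s) (weight a (flatten p) + 2 ^ a u + 2 ^ a x) (2 ^ a y + 2 ^ a z) →
      Within a (suc (suc e)) (path o s (flatten p ++ u ∷ x ∷ y ∷ []) z)
    split-off-last p u x y z e≤az fits =
      subst (λ l → Within a (suc (suc e)) (path o s l z)) (flatten-∷ʳ-++ p u x (y ∷ []))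
        (combine o
          (extended-prefix p u x y (Fits-prefix {P = weight a (flatten p) + 2 ^ a u} {x = 2 ^ a x} {y = 2 ^ a y}
            3≤e (<⇒≤ w<h) (^-monoʳ-≤ 2 e≤az) fits))
          (huffman a (dual o) (map proj₂ p′) (leaf z) light)
          (path-split o s p′ y [] z))
      where
      p′ = p ++ (u , x) ∷ []
      open ≤-Reasoning
      light : weight a (map proj₂ p′) + 2 ^ a z ≤ 2 ^ suc e
      light = begin
        weight a (map proj₂ p′) + 2 ^ a z
          ≤⟨ +-mono-≤ (weight-seconds-≤ a p′) (m≤n+m (2 ^ a z) (2 ^ a y)) ⟩
        weight a (flatten p′) + (2 ^ a y + 2 ^ a z)
          ≡⟨ cong (_+ (2 ^ a y + 2 ^ a z)) (weight-flatten-∷ʳ a p u x) ⟩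
        weight a (flatten p) + 2 ^ a u + 2 ^ a x + (2 ^ a y + 2 ^ a z)
          ≤⟨ Fits⇒R+Λ≤ (m≤n⇒m≤1+n 3≤e) fits ⟩
        2 ^ suc e
          ∎

    three-remaining : ∀ p u x y z → Within a (suc e) (path o s (flatten p) u) →
      Fits (suc e) (weight a s) (weight a (flatten p) + 2 ^ a u + 2 ^ a x) (2 ^ a y + 2 ^ a z) →
      Within a (suc (suc e)) (path o s (flatten p ++ u ∷ x ∷ y ∷ []) z)
    three-remaining p u x y z prefix fits with e ≤? a z | e ≤? a y
    ... | yes e≤az | _ = split-off-last p u x y z e≤az fits
    -- The last two entries are joined by one commutative operator, so `y` can take the place of
    -- `z`.
    ... | no _ | yes e≤ay =
      Within-cong
        (λ α → cong (reduce o α s) (alternate-++-cong o α (flatten p)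
          (λ o → cong (λ b → ⟦ o ⟧ (α u) (⟦ dual o ⟧ (α x) b)) (⟦⟧-comm (dual (dual o)) (α z) (α y)))))
        (split-off-last p u x z y e≤ay
          (subst (Fits (suc e) (weight a s) _) (+-comm (2 ^ a y) (2 ^ a z)) fits))
    -- Both arrival times are below `e`, so a gate on `y` and `z` has delay at most `e` and weight
    -- at most `2 ^ e`; all other entries together weigh less than `2 ^ e`.
    ... | no e≰az | no e≰ay =
      combine o prefix
        (huffman-∷ʳ a (dual o) (map proj₂ p) x (node (dual (dual o)) (leaf y) (leaf z)) light)
        (path-split o s p u (x ∷ y ∷ []) z)
      where
      open ≤-Reasoning
      R<h : weight a (flatten p) + 2 ^ a u + 2 ^ a x < 2 ^ e
      R<h = Fits⇒R< 3≤e (≤-trans (m^n>0 2 (a y)) (m≤m+n _ (2 ^ a z))) fits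
      light : weight a (map proj₂ p) + 2 ^ a x + 2 ^ suc (a y ⊔ a z) ≤ 2 ^ suc e
      light = begin
        weight a (map proj₂ p) + 2 ^ a x + 2 ^ suc (a y ⊔ a z)
          ≤⟨ +-mono-≤ (+-monoˡ-≤ (2 ^ a x) (≤-trans (weight-seconds-≤ a p) (m≤m+n _ (2 ^ a u))))
                      (^-monoʳ-≤ 2 (⊔-lub (≰⇒> e≰ay) (≰⇒> e≰az))) ⟩
        weight a (flatten p) + 2 ^ a u + 2 ^ a x + 2 ^ e
          ≤⟨ +-monoˡ-≤ (2 ^ e) (<⇒≤ R<h) ⟩
        2 ^ e + 2 ^ e
          ≡⟨ double (2 ^ e) ⟩
        2 ^ suc e
          ∎

    -- The search for the maximal prefix, carrying a realization of the current one, `flatten p`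
    -- followed by `u`.
    scan : ∀ p u r y z → Within a (suc e) (path o s (flatten p) u) →
      Fits (suc e) (weight a s) (weight a (flatten p) + 2 ^ a u + weight a r) (2 ^ a y + 2 ^ a z) →
      Within a (suc (suc e)) (path o s (flatten p ++ u ∷ r ++ y ∷ []) z)
    scan p u [] y z prefix fits =
      combine o prefix (huffman-∷ʳ a (dual o) (map proj₂ p) y (leaf z) light) (path-split o s p u (y ∷ []) z)
      where
      open ≤-Reasoning
      light : weight a (map proj₂ p) + 2 ^ a y + 2 ^ a z ≤ 2 ^ suc e
      light = begin
        weight a (map proj₂ p) + 2 ^ a y + 2 ^ a z
          ≡⟨ +-assoc (weight a (map proj₂ p)) (2 ^ a y) (2 ^ a z) ⟩
        weight a (map proj₂ p) + (2 ^ a y + 2 ^ a z)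
          ≤⟨ +-monoˡ-≤ (2 ^ a y + 2 ^ a z) (≤-trans (weight-seconds-≤ a p) (≤-trans (m≤m+n _ (2 ^ a u)) (m≤m+n _ 0))) ⟩
        weight a (flatten p) + 2 ^ a u + 0 + (2 ^ a y + 2 ^ a z)
          ≤⟨ Fits⇒R+Λ≤ (m≤n⇒m≤1+n 3≤e) fits ⟩
        2 ^ suc e
          ∎
    scan p u (x ∷ []) y z prefix fits =
      three-remaining p u x y z prefix
        (subst (λ k → Fits (suc e) (weight a s) (weight a (flatten p) + 2 ^ a u + k) (2 ^ a y + 2 ^ a z))
          (+-identityʳ (2 ^ a x)) fits)
    scan p u (x ∷ x′ ∷ r) y z prefix fits
      with Fits? e (weight a s) (weight a (flatten p) + 2 ^ a u) (2 ^ a x + 2 ^ a x′)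
    ... | yes fits′ =
      subst (λ l → Within a (suc (suc e)) (path o s l z)) (flatten-∷ʳ-++ p u x (x′ ∷ r ++ y ∷ []))
        (scan (p ++ (u , x) ∷ []) x′ r y z (extended-prefix p u x x′ fits′)
          (subst (λ R → Fits (suc e) (weight a s) R (2 ^ a y + 2 ^ a z)) regroup fits))
      where
      regroup : weight a (flatten p) + 2 ^ a u + (2 ^ a x + (2 ^ a x′ + weight a r)) ≡
                weight a (flatten (p ++ (u , x) ∷ [])) + 2 ^ a x′ + weight a r
      regroup = trans (sym (trans (+-assoc (P + 2 ^ a x) (2 ^ a x′) (weight a r)) (+-assoc P (2 ^ a x) _)))
        (cong (λ k → k + 2 ^ a x′ + weight a r) (sym (weight-flatten-∷ʳ a p u x)))
        where P = weight a (flatten p) + 2 ^ a u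
    -- At least four entries remain, so `x` and `x′` lie outside the last two and their weight is
    -- part of that of the remainder: this is `Q ≤ R` in `Fits-suffix`.
    ... | no unfit =
      combine o prefix
        (ih (dual o) (map proj₂ p) (x ∷ x′ ∷ r) y z (≤-<-trans seconds≤P (≤-<-trans (m≤m+n P _) R<h))
          (Fits-suffix {P = P} {Q = 2 ^ a x + 2 ^ a x′} 3≤e (<⇒≤ w<h) unfit
            (+-monoʳ-≤ (2 ^ a x) (m≤m+n (2 ^ a x′) (weight a r)))
            seconds≤P (<⇒≤ (≤-<-trans seconds≤P (≤-<-trans (m≤m+n P _) R<h))) fits))
        (path-split o s p u (x ∷ x′ ∷ r ++ y ∷ []) z)
      where
      P = weight a (flatten p) + 2 ^ a u
      seconds≤P : weight a (map proj₂ p) ≤ P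
      seconds≤P = ≤-trans (weight-seconds-≤ a p) (m≤m+n _ (2 ^ a u))
      R<h : P + weight a (x ∷ x′ ∷ r) < 2 ^ e
      R<h = Fits⇒R< 3≤e (≤-trans (m^n>0 2 (a y)) (m≤m+n _ (2 ^ a z))) fits

  split-off-reduce : ∀ o s r y z → 2 ^ e ≤ weight a s → weight a s < 2 ^ suc e →
    Fits (suc e) (weight a s) (weight a r) (2 ^ a y + 2 ^ a z) →
    Within a (suc (suc e)) (path o s (r ++ y ∷ []) z)
  split-off-reduce o [] r y z h≤w w<2h fits = contradiction h≤w (<⇒≱ (m^n>0 2 e))
  -- The head `x` serves as the compound operand of `huffman`, so the fold of the inputs needs no
  -- constant.
  split-off-reduce o (x ∷ s) r y z h≤w w<2h fits =
    combine o
      (huffman a o s (leaf x) (≤-trans (≤-reflexive (+-comm (weight a s) (2 ^ a x))) (<⇒≤ w<2h)))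
      (ih o [] r y z (m^n>0 2 e) (Fits-pred {R = weight a r} h≤w fits))
      λ α → let b = path o [] (r ++ y ∷ []) z α in begin
        ⟦ o ⟧ (α x) (reduce o α s b)    ≡⟨ ⟦⟧-comm o (α x) _ ⟩
        ⟦ o ⟧ (reduce o α s b) (α x)    ≡⟨ reduce-⟦⟧ o α s b (α x) ⟨
        reduce o α s (⟦ o ⟧ b (α x))    ≡⟨ cong (reduce o α s) (⟦⟧-comm o b (α x)) ⟩
        reduce o α s (⟦ o ⟧ (α x) b)    ≡⟨ reduce-⟦⟧ o α s (α x) b ⟩
        ⟦ o ⟧ (reduce o α s (α x)) b    ∎
    where open ≡-Reasoning

  solvable-∷ : ∀ o s x r y z → weight a s < 2 ^ suc e →
    Fits (suc e) (weight a s) (weight a (x ∷ r)) (2 ^ a y + 2 ^ a z) →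
    Within a (suc (suc e)) (path o s (x ∷ r ++ y ∷ []) z)
  solvable-∷ o s x r y z w<2h fits with weight a s <? 2 ^ e
  ... | no w≮h  = split-off-reduce o s (x ∷ r) y z (≮⇒≥ w≮h) w<2h fits
  -- The search starts from the prefix consisting of `x` alone: `s` and `x` each weigh less than
  -- `2 ^ e`.
  ... | yes w<h = scan o s w<h [] x r y z
    (huffman a o s (leaf x) (≤-trans (+-mono-≤ (<⇒≤ w<h) (<⇒≤ x<h)) (≤-reflexive (double (2 ^ e))))) fits
    where
    x<h : 2 ^ a x < 2 ^ e
    x<h = ≤-<-trans (m≤m+n _ (weight a r))
      (Fits⇒R< 3≤e (≤-trans (m^n>0 2 (a y)) (m≤m+n _ (2 ^ a z))) fits)

-- Small cases and the induction on d

w+Λ≤ : ∀ {e w Λ} → 1 ≤ e → w < 2 ^ e → Fits e w 0 Λ → w + Λ ≤ 2 ^ suc e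
w+Λ≤ {e} {w} {Λ} 1≤e w<h fits = begin
  w + Λ                      ≡⟨ cong (λ k → w + (k + Λ)) (*-zeroʳ (suc e)) ⟨
  w + (suc e * 0 + Λ)        ≤⟨ +-mono-≤ (m≤m+n w (w + 0)) (Fits⇒≤2* {R = 0} 1≤e fits) ⟩
  2 * w + 2 * (2 ^ e ∸ w)    ≡⟨ *-distribˡ-+ 2 w (2 ^ e ∸ w) ⟨
  2 * (w + (2 ^ e ∸ w))      ≡⟨ cong (2 *_) (m+[n∸m]≡n (<⇒≤ w<h)) ⟩
  2 ^ suc e                  ∎
  where open ≤-Reasoning

two-entries : ∀ {a : V → ℕ} {e} → 1 ≤ e → ∀ o s y z → weight a s < 2 ^ e →
  Fits e (weight a s) 0 (2 ^ a y + 2 ^ a z) → Within a (suc e) (path o s (y ∷ []) z)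
two-entries {a = a} 1≤e o s y z w<h fits = huffman-∷ʳ a o s y (leaf z)
  (≤-trans (≤-reflexive (+-assoc (weight a s) _ _)) (w+Λ≤ 1≤e w<h fits))

2^-+-2^≥2 : ∀ i j → 2 ≤ 2 ^ i + 2 ^ j
2^-+-2^≥2 i j = +-mono-≤ (m^n>0 2 i) (m^n>0 2 j)

-- Every weight is at least 1, so by monotonicity it is enough to refute the bound for unit weights
-- and `w = 0`, which is a numerical computation.
Fits-min : ∀ {e w R Λ R′ Λ′} → R ≤ R′ → Λ ≤ Λ′ → Fits e w R′ Λ′ → Fits e 0 R Λ
Fits-min {e} {w} {R} {Λ} R≤ Λ≤ (mkFits bound) =
  mkFits (≤-trans (^-monoʳ-≤ (suc e) (*-monoʳ-≤ 10 (+-mono-≤ (*-monoʳ-≤ (suc e) R≤) Λ≤)))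
    (≤-trans bound (^-monoʳ-≤ 2 (*-monoʳ-≤ 19 (m∸n≤m (2 ^ e) w)))))

solvable : (a : V → ℕ) → ∀ e → Solvable a (suc e)
solvable a e o s [] y z w<h fits = two-entries (s≤s z≤n) o s y z w<h fits
-- For d = 2 and d = 3, a third entry in t already violates the bound: 2 ^ 40 > 2 ^ 38 and 3 ^ 50 >
-- 2 ^ 76.
solvable a 0 o s (x ∷ r) y z w<h fits =
  contradiction (Fits-min {1} {R = 1} (≤-trans (m^n>0 2 (a x)) (m≤m+n _ (weight a r)))
      (2^-+-2^≥2 (a y) (a z)) fits)
    (from-no (Fits? 1 0 1 2))
solvable a 1 o s (x ∷ r) y z w<h fits =
  contradiction (Fits-min {2} {R = 1} (≤-trans (m^n>0 2 (a x)) (m≤m+n _ (weight a r)))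
      (2^-+-2^≥2 (a y) (a z)) fits)
    (from-no (Fits? 2 0 1 2))
-- For d = 4 a fourth entry violates the bound: 4 ^ 100 > 2 ^ 152.
solvable a 2 o s (x ∷ x′ ∷ r) y z w<h fits =
  contradiction (Fits-min {3} {R = 2} (+-mono-≤ (m^n>0 2 (a x)) (≤-trans (m^n>0 2 (a x′)) (m≤m+n _ (weight a r))))
      (2^-+-2^≥2 (a y) (a z)) fits)
    (from-no (Fits? 3 0 2 2))
-- With three entries, the gate on `y` and `z` weighs at most twice their sum, and doubling the
-- bound for d = 4 leaves room for this.
solvable a 2 o s (x ∷ []) y z w<h fits =
  huffman-∷ʳ a o s x (node (dual o) (leaf y) (leaf z)) (begin
    w + 2 ^ a x + 2 * 2 ^ (a y ⊔ a z)   ≤⟨ +-monoʳ-≤ (w + 2 ^ a x) (*-monoʳ-≤ 2 2^⊔≤) ⟩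
    w + 2 ^ a x + 2 * Λ′                ≤⟨ m≤m+n _ (w + 7 * 2 ^ a x) ⟩
    w + 2 ^ a x + 2 * Λ′ + (w + 7 * 2 ^ a x)  ≡⟨ regroup w (2 ^ a x) Λ′ ⟩
    2 * (w + (4 * (2 ^ a x + 0) + Λ′))  ≤⟨ *-monoʳ-≤ 2 (+-monoʳ-≤ w (Fits⇒≤ {R = 2 ^ a x + 0} ≤-refl fits)) ⟩
    2 * (w + (8 ∸ w))                   ≡⟨ cong (2 *_) (m+[n∸m]≡n (<⇒≤ w<h)) ⟩
    16                                  ∎)
  where
  open ≤-Reasoning
  w = weight a s
  Λ′ = 2 ^ a y + 2 ^ a z
  2^⊔≤ : 2 ^ (a y ⊔ a z) ≤ Λ′
  2^⊔≤ with ⊔-sel (a y) (a z)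
  ... | inj₁ eq rewrite eq = m≤m+n _ _
  ... | inj₂ eq rewrite eq = m≤n+m _ _
  regroup : ∀ i j k → i + j + 2 * k + (i + 7 * j) ≡ 2 * (i + (4 * (j + 0) + k))
  regroup = solve-∀
solvable a (suc (suc (suc e))) o s (x ∷ r) y z w<h fits =
  solvable-∷ (m≤m+n 3 e) (solvable a (suc (suc e))) o s x r y z w<h fits

-- From lists back to vectors

-- A relation rather than an equation with a concatenation, so that no vector has to be transported
-- along an equality of lengths.
data EndsWith {A : Set} : ∀ {k} → Vec A (2 + k) → List A → A → A → Set where
  done : ∀ {y z} → EndsWith (y ∷ z ∷ []) [] y z
  next : ∀ {k x r y z} {t : Vec A (2 + k)} → EndsWith t r y z → EndsWith (x ∷ t) (x ∷ r) y z

endsWith : ∀ {A : Set} {k} (t : Vec A (2 + k)) → ∃ λ r → ∃ λ y → ∃ λ z → EndsWith t r y z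
endsWith (y ∷ z ∷ [])    = [] , y , z , done
endsWith (x ∷ t@(_ ∷ _ ∷ _)) with endsWith t
... | r , y , z , v = x ∷ r , y , z , next v

altPath : ∀ {k} → Op → Vec Bool (suc k) → Bool
altPath AND = g
altPath OR  = g*

altPath-∷ : ∀ {k} o x (t : Vec Bool (suc k)) → altPath o (x ∷ t) ≡ ⟦ o ⟧ x (altPath (dual o) t)
altPath-∷ AND x (_ ∷ _) = refl
altPath-∷ OR  x (_ ∷ _) = refl

altPath-singleton : ∀ o x → altPath o (x ∷ []) ≡ x
altPath-singleton AND x = refl
altPath-singleton OR  x = refl

altPath-alternate : ∀ {A : Set} {k} {t : Vec A (2 + k)} {r y z} (h : A → Bool) o → EndsWith t r y z →
  altPath o (Vec.map h t) ≡ alternate o h (r ++ y ∷ []) (h z)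
altPath-alternate {y = y} {z} h o done =
  trans (altPath-∷ o (h y) (h z ∷ [])) (cong (⟦ o ⟧ (h y)) (altPath-singleton (dual o) (h z)))
altPath-alternate {t = x ∷ t} h o (next v) =
  trans (altPath-∷ o (h x) (Vec.map h t)) (cong (⟦ o ⟧ (h x)) (altPath-alternate h (dual o) v))

W-EndsWith : ∀ {A : Set} {k} {t : Vec A (2 + k)} {r y z} (a : A → ℕ) → EndsWith t r y z →
  W (Vec.map a t) ≡ weight a r + (2 ^ a y + 2 ^ a z)
W-EndsWith {y = y} {z} a done = cong (2 ^ a y +_) (+-identityʳ (2 ^ a z))
W-EndsWith {t = x ∷ t} a (next v) = trans (cong (2 ^ a x +_) (W-EndsWith a v)) (sym (+-assoc (2 ^ a x) _ _))

Λ-EndsWith : ∀ {A : Set} {k} {t : Vec A (2 + k)} {r y z} (a : A → ℕ) → EndsWith t r y z →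
  Λ (Vec.map a t) ≡ 2 ^ a y + 2 ^ a z
Λ-EndsWith a done = refl
Λ-EndsWith {t = _ ∷ _ ∷ _ ∷ _} a (next v) = Λ-EndsWith a v

W-toList : ∀ {A : Set} {n} (a : A → ℕ) (s : Vec A n) → W (Vec.map a s) ≡ weight a (Vec.toList s)
W-toList a []      = refl
W-toList a (x ∷ s) = cong (2 ^ a x +_) (W-toList a s)

⋀-toList : ∀ {A : Set} {n} (h : A → Bool) (s : Vec A n) b →
  ⋀ (Vec.map h s) ∧ b ≡ reduce AND h (Vec.toList s) b
⋀-toList h []      b = refl
⋀-toList h (x ∷ s) b = trans (∧-assoc (h x) _ b) (cong (h x ∧_) (⋀-toList h s b))

-- For W(t) = R + Λ, the difference d W(t) - (d - 1) Λ is d R + Λ, so the truncated subtraction is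
-- exact.
PaperBound⇒Fits : ∀ {e w} R Λt → PaperBound (suc e) w (R + Λt) Λt → Fits e w R Λt
PaperBound⇒Fits {e} {w} R Λt bound = mkFits (subst (λ k → suc e ^ (10 * k) ≤ 2 ^ (19 * (2 ^ e ∸ w))) (begin
  suc e * (R + Λt) ∸ e * Λt                ≡⟨ cong (_∸ e * Λt) (regroup e R Λt) ⟩
  suc e * R + Λt + e * Λt ∸ e * Λt         ≡⟨ m+n∸n≡m _ (e * Λt) ⟩
  suc e * R + Λt                           ∎) bound)
  where
  open ≡-Reasoning
  regroup : ∀ i j k → (1 + i) * (j + k) ≡ (1 + i) * j + k + i * k
  regroup = solve-∀

formula : ∀ {A : Set} {n m} (a : A → ℕ) e (s : Vec A n) (t : Vec A (suc m)) → W (Vec.map a s) < 2 ^ suc e →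
  PaperBound (2 + e) (W (Vec.map a s)) (W (Vec.map a t)) (Λ (Vec.map a t)) →
  Within a (2 + e) (λ α → f (Vec.map α s) (Vec.map α t))
-- A single entry has Λ = W(t), so the bound holds with `R = 0` and Huffman coding suffices.
formula {m = zero} a e s (x ∷ []) w<h bound rewrite W-toList a s | +-identityʳ (2 ^ a x) =
  Within-cong (λ α → sym (⋀-toList α s (α x)))
    (huffman a AND (Vec.toList s) (leaf x) (w+Λ≤ (s≤s z≤n) w<h (PaperBound⇒Fits 0 (2 ^ a x) bound)))
formula {m = suc m} a e s t w<h bound with endsWith t
... | r , y , z , v rewrite W-toList a s | W-EndsWith a v | Λ-EndsWith a v =
  Within-cong
    (λ α → sym (trans (⋀-toList α s (g (Vec.map α t)))
      (cong (reduce AND α (Vec.toList s)) (altPath-alternate α AND v))))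
    (solvable a e AND (Vec.toList s) r y z w<h (PaperBound⇒Fits (weight a r) (2 ^ a y + 2 ^ a z) bound))

theorem3p6 : (d w : ℕ) → 1 < d → w < 2 ^ (d ∸ 1) →
    (n m : ℕ) (as : Vec ℕ n) (at : Vec ℕ (suc m)) →
    W as ≡ w →
    PaperBound d w (W at) (Λ at) →
    Σ (Circuit (Var n m)) λ C →
    Circuit.Realizes C fST × Circuit.DelayAtMost C (arrival as at) d
theorem3p6 (suc zero) w (s≤s ()) _ _ _ _ _ _ _
theorem3p6 (suc (suc e)) _ _ w<h n m as at refl bound =
  toCircuit φ
  , (λ α val con → trans (toCircuit-realizes φ α val con) (trans (φ≡ α)
      (cong₂ f (sym (tabulate-∘ α inj₁)) (sym (tabulate-∘ α inj₂)))))
  , λ u x eq c p → ≤-trans (toCircuit-delay φ a u x eq c p) φ≤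
  where
  a : Var n m → ℕ
  a = arrival as at
  -- The arrival times are presented as images of vectors of variables, so that one vector
  -- determines both weights and Boolean values.
  as≡ : as ≡ Vec.map a (Vec.tabulate inj₁)
  as≡ = trans (sym (tabulate∘lookup as)) (tabulate-∘ a inj₁)
  at≡ : at ≡ Vec.map a (Vec.tabulate inj₂)
  at≡ = trans (sym (tabulate∘lookup at)) (tabulate-∘ a inj₂)
  realization : Within a (2 + e) (λ α → f (Vec.map α (Vec.tabulate inj₁)) (Vec.map α (Vec.tabulate inj₂)))
  realization = formula a e (Vec.tabulate inj₁) (Vec.tabulate inj₂)
    (subst (λ v → W v < 2 ^ suc e) as≡ w<h)
    (subst₂ (λ v v′ → PaperBound (2 + e) (W v) (W v′) (Λ v′)) as≡ at≡ bound)
  φ = proj₁ realization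
  φ≤ = proj₁ (proj₂ realization)
  φ≡ = proj₂ (proj₂ realization)
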